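{- Let $\mathrm{Prop}$ be a set of propositional variables. For each $\varphi\in\mathcal{L}_{\Box,\Diamond,\wedge,\vee}[\mathrm{Prop}]$, the pair $(E^+_\varphi,E^-_\varphi)$ is a weak simulation duality that $\varphi$ fits (i.e. $\varphi$ is true at every pointed model in $E^+_\varphi$ and false at every pointed model in $E^-_\varphi$).
   Context: $\mathcal{L}:=\mathcal{L}_{\Box,\Diamond,\wedge,\vee}[\mathrm{Prop}]$ is the set of modal formulas generated from variables in $\mathrm{Prop}$ using only $\Box,\Diamond$ and binary $\wedge,\vee$; $d(\varphi)$ is the modal depth (maximal nesting of modal operators). A Kripke model is $M=(dom(M),R,v)$ with $R\subseteq dom(M)^2$, $v:dom(M)\to\mathcal{P}(\mathrm{Prop})$; a pointed model is $(M,s)$ with $s\in dom(M)$; satisfaction is standard Kripke semantics and $\underline{\leftrightarrow}$ is standard bisimilarity. $\circlearrowright_{\emptyset}$ (resp. $\circlearrowright_{\mathrm{Prop}}$) is the pointed model with a single reflexive point at which no (resp. every) $p\in\mathrm{Prop}$ is true. Weak simulations. A weak simulation from $(M,s)$ to $(M',s')$ is a relation $Z\subseteq dom(M)\times dom(M')$ with $(s,s')\in Z$ such that for all $(t,t')\in Z$: (atom) $v^M(t)\subseteq v^{M'}(t')$; (forth') if $R^Mtu$, then either $M,u\mathrel{\underline{\leftrightarrow}}\circlearrowright_{\emptyset}$ or there is $u'$ with $R^{M'}t'u'$ and $(u,u')\in Z$; (back') if $R^{M'}t'u'$, then either $M',u'\mathrel{\underline{\leftrightarrow}}\circlearrowright_{\mathrm{Prop}}$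 or there is $u$ with $R^Mtu$ and $(u,u')\in Z$. If one exists, $(M',s')$ weakly simulates $(M,s)$, and $(M,s)$ is weakly simulated by $(M',s')$. A weak simulation duality is a pair $(\mathcal{D}_{pos},\mathcal{D}_{neg})$ of finite sets of pointed models such that every pointed model over $\mathrm{Prop}$ either weakly simulates some member of $\mathcal{D}_{pos}$ or is weakly simulated by some member of $\mathcal{D}_{neg}$, but not both. Normal forms. A basic normal form of level $0$ is a non-empty conjunction of propositional variables. A basic normal form of level $k+1$ is a non-empty conjunction of the form $\pi\wedge\Diamond\varphi_0\wedge\ldots\wedge\Diamond\varphi_n\wedge\Box(\psi_0\vee\ldots\vee\psi_m)$, where $\pi$ is a (possibly empty) conjunction of variables, the diamond conjuncts and/or the box conjunct may be absent, and all $\varphi_i,\psi_j$ are basic normal forms of level at most $k$. A normal form of level $k$ is a non-empty disjunction of basic normal forms of level $k$. Every $\xi\in\mathcal{L}$ is equivalent to a normal form of level $d(\xi)$; fix one such, $nf(\xi)$, with $nf(\xi)=\xi$ if $\xi$ already is a normal form. Positive examples. For a set $\mathbb{E}$ of pointed models and $P\subseteq\mathrm{Prop}$, $\blacktriangledown_P(\mathbb{E})$ is the pointed model obtained from the disjoint union of the models in $\mathbb{E}$ by adding a new distinguished root $r$ with $v(r)=P$ whose successors are exactly the distinguished points of the members of $\mathbb{E}$. For a conjunction $\pi$ of variables, $\hat\pi$ is the set of variables occurring in it. By recursion on modal depth define $E^+_{\pi}:=\{\blacktriangledown_{\hat\pi}(\{\circlearrowright_{\emptyset}\})\}$; $E^+_{\pi\wedge\Diamond\varphi_0\wedge\ldots\wedge\Diamond\varphi_n}:=\{\blacktriangledown_{\hat\pi}(\{E_0,\ldots,E_n\}\cup\{\circlearrowright_{\emptyset}\})\mid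 E_i\in E^+_{\varphi_i}\text{ for all }i\le n\}$; $E^+_{\pi\wedge\Box(\psi_0\vee\ldots\vee\psi_m)}:=\{\blacktriangledown_{\hat\pi}(\mathbb{E})\mid\mathbb{E}\subseteq\bigcup_{j\le m}E^+_{\psi_j}\}$; $E^+_{\pi\wedge\Diamond\varphi_0\wedge\ldots\wedge\Diamond\varphi_n\wedge\Box(\psi_0\vee\ldots\vee\psi_m)}:=\{\blacktriangledown_{\hat\pi}(\{E_0,\ldots,E_n\}\cup\mathbb{E})\mid E_i\in\bigcup_{j\le m}E^+_{\varphi_i\wedge\psi_j}\text{ for all }i\le n,\ \emptyset\ne\mathbb{E}\subseteq\bigcup_{j\le m}E^+_{\psi_j}\}$, where $E^+_{\varphi_i\wedge\psi_j}:=E^+_{nf(\varphi_i\wedge\psi_j)}$; $E^+_{\bigvee_{i\le n}\varphi_i}:=\bigcup_{i\le n}E^+_{\varphi_i}$; and for arbitrary $\varphi\in\mathcal{L}$ put $E^+_\varphi:=E^+_{nf(\varphi)}$. Negative examples. For a model $M=(dom(M),R,v)$, $M^{\neg}:=(dom(M),R,v^{\neg})$ with $v^{\neg}(t)=\mathrm{Prop}\setminus v(t)$. For $\varphi\in\mathcal{L}$, $\triangleleft(\varphi)$ is obtained by swapping $\Box$ with $\Diamond$ and $\wedge$ with $\vee$ throughout, leaving variables unchanged. Then $E^-_\varphi:=\{(E^{\neg},e)\mid(E,e)\in E^+_{nf(\triangleleft(\varphi))}\}$. -}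

module Defs where

open import Data.Fin.Base using (Fin)
open import Data.List.Base as List
  using (List; []; _∷_; [_]; _++_; length; lookup; concatMap; cartesianProductWith)
open import Data.List.Membership.Propositional using (_∈_)
open import Data.List.NonEmpty.Base as List⁺
  using (List⁺; _∷_; _⁺++_; toList)
  renaming (_++⁺_ to _⧺_)
open import Data.List.Relation.Unary.All as All using (All; []; _∷_)
open import Data.List.Relation.Unary.All.Properties using (map⁺; ++⁺)
open import Data.List.Relation.Unary.Any using (Any)
open import Data.Maybe.Base using (Maybe; nothing; just; maybe)
open import Data.Nat.Base using (ℕ; zero; suc; _⊔_; _≤_; z≤n; s≤s)
open import Data.Nat.Properties using (⊔-lub)
open import Data.Product.Base using (Σ; _×_; _,_; ∃-syntax)
open import Data.Sum.Base using (_⊎_)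
open import Data.Unit.Base using (⊤; tt)
open import Function.Base using (_∘_)
open import Function.Bundles using (_⇔_)
open import Level using (0ℓ)
open import Relation.Binary.PropositionalEquality using (_≡_)
open import Relation.Nullary.Negation.Core using (¬_)
open import Relation.Unary using (Pred; _⊆_; _≐_; ∁; ∅; U)

private
  variable
    Var : Set
    k l : ℕ

infixr 7 _∧_
infixr 6 _∨_
infix  8 ◇_ □_

data Formula (Var : Set) : Set where
  var     : Var → Formula Var
  ◇_ □_   : Formula Var → Formula Var
  _∧_ _∨_ : Formula Var → Formula Var → Formula Var

depth : Formula Var → ℕ
depth (var p) = 0
depth (◇ φ)   = suc (depth φ)
depth (□ φ)   = suc (depth φ)
depth (φ ∧ ψ) = depth φ ⊔ depth ψ
depth (φ ∨ ψ) = depth φ ⊔ depth ψ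

◁ : Formula Var → Formula Var
◁ (var p) = var p
◁ (◇ φ)   = □ (◁ φ)
◁ (□ φ)   = ◇ (◁ φ)
◁ (φ ∧ ψ) = ◁ φ ∨ ◁ ψ
◁ (φ ∨ ψ) = ◁ φ ∧ ◁ ψ

record Model (Var : Set) : Set₁ where
  field
    dom : Set
    R   : dom → dom → Set
    v   : dom → Pred Var 0ℓ

open Model public

record PointedModel (Var : Set) : Set₁ where
  constructor _▸_
  field
    model : Model Var
    point : dom model

open PointedModel public

infix 4 _,_⊨_ _⊨_

_,_⊨_ : (M : Model Var) → dom M → Formula Var → Set
M , s ⊨ var p = v M s p
M , s ⊨ ◇ φ   = ∃[ t ] R M s t × (M , t ⊨ φ)
M , s ⊨ □ φ   = ∀ t → R M s t → M , t ⊨ φ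
M , s ⊨ φ ∧ ψ = (M , s ⊨ φ) × (M , s ⊨ ψ)
M , s ⊨ φ ∨ ψ = (M , s ⊨ φ) ⊎ (M , s ⊨ ψ)

_⊨_ : PointedModel Var → Formula Var → Set
(M ▸ s) ⊨ φ = M , s ⊨ φ

record IsBisimulation (M M′ : Model Var) (Z : dom M → dom M′ → Set) : Set where
  field
    atom  : ∀ {t t′} → Z t t′ → v M t ≐ v M′ t′
    forth : ∀ {t t′ u} → Z t t′ → R M t u → ∃[ u′ ] R M′ t′ u′ × Z u u′
    back  : ∀ {t t′ u′} → Z t t′ → R M′ t′ u′ → ∃[ u ] R M t u × Z u u′

infix 4 _↔_ _≼_

_↔_ : PointedModel Var → PointedModel Var → Set₁
(M ▸ s) ↔ (M′ ▸ s′) = ∃[ Z ] IsBisimulation M M′ Z × Z s s′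

negate : PointedModel Var → PointedModel Var
negate (M ▸ s) = record { dom = dom M ; R = R M ; v = ∁ ∘ v M } ▸ s

loop : Pred Var 0ℓ → PointedModel Var
loop P = record { dom = ⊤ ; R = λ _ _ → ⊤ ; v = λ _ → P } ▸ tt

↻∅ ↻Prop : PointedModel Var
↻∅    = loop ∅
↻Prop = loop U

record IsWeakSimulation (M M′ : Model Var) (Z : dom M → dom M′ → Set) : Set₁ where
  field
    atom   : ∀ {t t′} → Z t t′ → v M t ⊆ v M′ t′
    forth′ : ∀ {t t′ u} → Z t t′ → R M t u →
             ((M ▸ u) ↔ ↻∅) ⊎ (∃[ u′ ] R M′ t′ u′ × Z u u′)
    back′  : ∀ {t t′ u′} → Z t t′ → R M′ t′ u′ →
             ((M′ ▸ u′) ↔ ↻Prop) ⊎ (∃[ u ] R M t u × Z u u′)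

-- 𝕄 ≼ 𝕄′ : 𝕄 is weakly simulated by 𝕄′, i.e. 𝕄′ weakly simulates 𝕄.
_≼_ : PointedModel Var → PointedModel Var → Set₁
(M ▸ s) ≼ (M′ ▸ s′) = ∃[ Z ] IsWeakSimulation M M′ Z × Z s s′

-- Finite sets of pointed models are represented by lists throughout.  A model
-- listed twice contributes two copies to a disjoint union, which is bisimilar
-- to contributing one.
IsWeakSimulationDuality : (Dpos Dneg : List (PointedModel Var)) → Set₁
IsWeakSimulationDuality Dpos Dneg =
  ∀ 𝕄 → (Any (_≼ 𝕄) Dpos ⊎ Any (𝕄 ≼_) Dneg) × ¬ (Any (_≼ 𝕄) Dpos × Any (𝕄 ≼_) Dneg)

Fits : Formula Var → (Epos Eneg : List (PointedModel Var)) → Set₁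
Fits φ Epos Eneg = All (_⊨ φ) Epos × All (λ 𝔼 → ¬ (𝔼 ⊨ φ)) Eneg

-- List⁺.foldr₁ hides its recursion in a where-block that captures the whole
-- list, which blocks induction on it.
foldr¹ : {A : Set} → (A → A → A) → A → List A → A
foldr¹ _∙_ x []       = x
foldr¹ _∙_ x (y ∷ ys) = x ∙ foldr¹ _∙_ y ys

⋀ ⋁ : List⁺ (Formula Var) → Formula Var
⋀ (φ ∷ φs) = foldr¹ _∧_ φ φs
⋁ (φ ∷ φs) = foldr¹ _∨_ φ φs

-- BNF Var k are the basic normal forms of level k.  Levels are cumulative (see
-- lift), so the components "of level at most k" of a basic normal form of level
-- k + 1 are given as elements of BNF Var k.  The diamonds, the box, or
-- both may be absent; only if both are does π have to be non-empty.
data BNF (Var : Set) : ℕ → Set where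
  conj    : (π : List⁺ Var) → BNF Var k
  conj-◇  : (π : List Var) (φs : List⁺ (BNF Var k)) → BNF Var (suc k)
  conj-□  : (π : List Var) (ψs : List⁺ (BNF Var k)) → BNF Var (suc k)
  conj-◇□ : (π : List Var) (φs ψs : List⁺ (BNF Var k)) → BNF Var (suc k)

NF : Set → ℕ → Set
NF Var k = List⁺ (BNF Var k)

⌜_⌝ : BNF Var k → Formula Var
⌜_⌝             (conj π)          = ⋀ (List⁺.map var π)
⌜_⌝ {k = suc k} (conj-◇ π φs)     =
  ⋀ (List.map var π ⧺ List⁺.map (◇_ ∘ ⌜_⌝ {k = k}) φs)
⌜_⌝ {k = suc k} (conj-□ π ψs)     =
  ⋀ (List.map var π ⧺ List⁺.[ □ ⋁ (List⁺.map (⌜_⌝ {k = k}) ψs) ])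
⌜_⌝ {k = suc k} (conj-◇□ π φs ψs) =
  ⋀ (List.map var π ⧺ List⁺.map (◇_ ∘ ⌜_⌝ {k = k}) φs
                    ⁺++ [ □ ⋁ (List⁺.map (⌜_⌝ {k = k}) ψs) ])

⌜_⌝ⁿ : NF Var k → Formula Var
⌜ φs ⌝ⁿ = ⋁ (List⁺.map ⌜_⌝ φs)

lift : k ≤ l → BNF Var k → BNF Var l
lift k≤l       (conj π)          = conj π
lift (s≤s k≤l) (conj-◇ π φs)     = conj-◇ π (List⁺.map (lift k≤l) φs)
lift (s≤s k≤l) (conj-□ π ψs)     = conj-□ π (List⁺.map (lift k≤l) ψs)
lift (s≤s k≤l) (conj-◇□ π φs ψs) =
  conj-◇□ π (List⁺.map (lift k≤l) φs) (List⁺.map (lift k≤l) ψs)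

Shallow : ℕ → Formula Var → Set
Shallow k φ = depth φ ≤ k

All⁺ : {A : Set} → (A → Set) → List⁺ A → Set
All⁺ P = All P ∘ toList

⋀-shallow : (φs : List⁺ (Formula Var)) → All⁺ (Shallow k) φs → Shallow k (⋀ φs)
⋀-shallow (φ ∷ [])     (p ∷ _)  = p
⋀-shallow (φ ∷ ψ ∷ φs) (p ∷ ps) = ⊔-lub p (⋀-shallow (ψ ∷ φs) ps)

⋁-shallow : (φs : List⁺ (Formula Var)) → All⁺ (Shallow k) φs → Shallow k (⋁ φs)
⋁-shallow (φ ∷ [])     (p ∷ _)  = p
⋁-shallow (φ ∷ ψ ∷ φs) (p ∷ ps) = ⊔-lub p (⋁-shallow (ψ ∷ φs) ps)

var-shallow : ∀ (π : List Var) φs → All⁺ (Shallow k) φs →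
              All⁺ (Shallow k) (List.map var π ⧺ φs)
var-shallow []      φs ps = ps
var-shallow (_ ∷ π) φs ps = z≤n ∷ var-shallow π φs ps

map-shallow : {A : Set} {f : A → Formula Var} → (∀ x → Shallow k (f x)) →
              ∀ xs → All⁺ (Shallow k) (List⁺.map f xs)
map-shallow h xs = map⁺ (All.universal h (toList xs))

⌜⌝-shallow : (φ : BNF Var k) → Shallow k ⌜ φ ⌝
⌜⌝-shallow (conj π) = ⋀-shallow (List⁺.map var π) (map-shallow (λ _ → z≤n) π)
⌜⌝-shallow {k = suc k} (conj-◇ π φs) =
  ⋀-shallow _ (var-shallow π _ (map-shallow (λ φ → s≤s (⌜⌝-shallow {k = k} φ)) φs))
⌜⌝-shallow {k = suc k} (conj-□ π ψs) =
  ⋀-shallow _ (var-shallow π _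
    (s≤s (⋁-shallow _ (map-shallow (⌜⌝-shallow {k = k}) ψs)) ∷ []))
⌜⌝-shallow {k = suc k} (conj-◇□ π φs ψs) =
  ⋀-shallow _ (var-shallow π _
    (++⁺ (map-shallow (λ φ → s≤s (⌜⌝-shallow {k = k} φ)) φs)
         (s≤s (⋁-shallow _ (map-shallow (⌜⌝-shallow {k = k}) ψs)) ∷ [])))

-- A choice, for each formula, of one equivalent normal form of level its depth.
record NormalForms (Var : Set) : Set₁ where
  field
    nf       : (ξ : Formula Var) → NF Var (depth ξ)
    nf-equiv : ∀ ξ (𝕄 : PointedModel Var) → (𝕄 ⊨ ξ) ⇔ (𝕄 ⊨ ⌜ nf ξ ⌝ⁿ)
    nf-id    : ∀ {k} (φ : NF Var k) → ⌜ nf ⌜ φ ⌝ⁿ ⌝ⁿ ≡ ⌜ φ ⌝ⁿ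

-- The successors of the root are indexed by positions in 𝔼s.
data ▼R {Var : Set} (𝔼s : List (PointedModel Var)) :
     (t u : Maybe (Σ (Fin (length 𝔼s)) λ i → dom (model (lookup 𝔼s i)))) → Set where
  root  : ∀ i → ▼R 𝔼s nothing (just (i , point (lookup 𝔼s i)))
  inner : ∀ i {t u} → R (model (lookup 𝔼s i)) t u → ▼R 𝔼s (just (i , t)) (just (i , u))

▼ : Pred Var 0ℓ → List (PointedModel Var) → PointedModel Var
▼ P 𝔼s = record
  { dom = Maybe (Σ (Fin (length 𝔼s)) λ i → dom (model (lookup 𝔼s i)))
  ; R   = ▼R 𝔼s
  ; v   = maybe (λ (i , t) → v (model (lookup 𝔼s i)) t) P
  } ▸ nothing

module _ {A : Set₁} where

  nonEmptySubsets subsets : List A → List (List A)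
  nonEmptySubsets []       = []
  nonEmptySubsets (x ∷ xs) = List.map (x ∷_) (subsets xs) ++ nonEmptySubsets xs
  subsets xs = [] ∷ nonEmptySubsets xs

  -- All lists (x₀, …, xₙ) with xᵢ drawn from the i-th given list.
  choices : List (List A) → List (List A)
  choices = List.foldr (cartesianProductWith _∷_) [ [] ]

module _ {Var : Set} (N : NormalForms Var) where

  open NormalForms N

  mutual

    E⁺ᵇ : ∀ k → BNF Var k → List (PointedModel Var)
    E⁺ᵇ _       (conj π)          = [ ▼ (_∈ toList π) [ ↻∅ ] ]
    E⁺ᵇ (suc k) (conj-◇ π φs)     =
      List.map (λ 𝔼s → ▼ (_∈ π) (𝔼s ++ [ ↻∅ ]))
               (choices (List.map (E⁺ᵇ k) (toList φs)))
    E⁺ᵇ (suc k) (conj-□ π ψs)     =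
      List.map (▼ (_∈ π)) (subsets (E⁺ⁿ k ψs))
    E⁺ᵇ (suc k) (conj-◇□ π φs ψs) =
      cartesianProductWith (λ 𝔼s 𝔽s → ▼ (_∈ π) (𝔼s ++ 𝔽s))
        (choices (List.map (λ φ → concatMap (E⁺∧ k φ) (toList ψs)) (toList φs)))
        (nonEmptySubsets (E⁺ⁿ k ψs))

    E⁺ⁿ : ∀ k → NF Var k → List (PointedModel Var)
    E⁺ⁿ k φs = concatMap (E⁺ᵇ k) (toList φs)

    E⁺∧ : ∀ k → BNF Var k → BNF Var k → List (PointedModel Var)
    E⁺∧ k φ ψ = E⁺ⁿ k (List⁺.map (lift (⊔-lub (⌜⌝-shallow φ) (⌜⌝-shallow ψ)))
                                 (nf (⌜ φ ⌝ ∧ ⌜ ψ ⌝)))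

  E⁺ : Formula Var → List (PointedModel Var)
  E⁺ φ = E⁺ⁿ (depth φ) (nf φ)

  E⁻ : Formula Var → List (PointedModel Var)
  E⁻ φ = List.map negate (E⁺ (◁ φ))

{-# OPTIONS --safe #-}
module Submission where

-- Weak simulations preserve formulas, because ↻∅ satisfies no formula and ↻Prop
-- satisfies all of them.  So it is enough that the members of E⁺ φ satisfy φ and
-- that every model of φ lies ≼-above one of them; both are shown by induction on
-- the level of the normal form.  In the second part, a box is matched by taking
-- for the subset of positive examples those that lie below some successor of the
-- given world.  The negative half follows by negation, which reverses ≼ and
-- exchanges φ with ◁ φ up to complement.

open import Axiom.ExcludedMiddle using (ExcludedMiddle)
open import Data.List.Base as List
  using (List; []; _∷_; [_]; _++_; lookup; concatMap; cartesianProductWith)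
open import Data.List.Membership.Propositional using (_∈_; find; lose)
open import Data.List.Membership.Propositional.Properties using (∈-lookup)
open import Data.List.NonEmpty.Base as List⁺ using (List⁺; _∷_; toList)
  renaming (_++⁺_ to _⧺_)
import Data.List.NonEmpty.Properties as List⁺ₚ
open import Data.List.Relation.Unary.All as All using (All; []; _∷_)
import Data.List.Relation.Unary.All.Properties as Allₚ
open import Data.List.Relation.Unary.Any as Any using (Any; here; there)
import Data.List.Relation.Unary.Any.Properties as Anyₚ
open import Data.Maybe.Base using (nothing; just)
open import Data.Nat.Base as ℕ using (ℕ; _≤_; s≤s)
open import Data.Nat.Properties using (⊔-lub)
open import Data.Product.Base using (_×_; _,_; proj₁; proj₂; ∃-syntax; map₂)
open import Data.Sum.Base as Sum using (_⊎_; inj₁; inj₂)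
open import Data.Unit.Base using (⊤; tt)
open import Function.Base using (_∘_; id)
open import Function.Bundles using (module Equivalence)
open import Level using (0ℓ; suc; lift; lower)
open import Relation.Binary.PropositionalEquality
  using (_≡_; refl; sym; trans; cong; cong₂; subst; setoid)
open import Relation.Nullary.Decidable.Core
  using (yes; no; True; toWitness; fromWitness; map′; decidable-stable)
open import Relation.Nullary.Negation.Core using (¬_; contradiction)
open import Relation.Unary using (Pred; _⊆_)
open import Defs hiding (lift)
import Defs

private
  variable
    Var : Set
    M M′ : Model Var
    𝕄 𝕄′ 𝕄″ : PointedModel Var
    𝔼s : List (PointedModel Var)
    k l : ℕ

-- Bisimulations and weak simulations

↔-refl : 𝕄 ↔ 𝕄
↔-refl = _≡_ , record
  { atom  = λ { refl → id , id }
  ; forth = λ { refl r → _ , r , refl }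
  ; back  = λ { refl r → _ , r , refl }
  } , refl

↔-sym : 𝕄 ↔ 𝕄′ → 𝕄′ ↔ 𝕄
↔-sym (Z , bis , z) = (λ t′ t → Z t t′) , record
  { atom  = λ z → let (f , g) = B.atom z in g , f
  ; forth = B.back
  ; back  = B.forth
  } , z
  where module B = IsBisimulation bis

↔-trans : 𝕄 ↔ 𝕄′ → 𝕄′ ↔ 𝕄″ → 𝕄 ↔ 𝕄″
↔-trans (Z , bis , z) (Z′ , bis′ , z′) = (λ t t″ → ∃[ t′ ] Z t t′ × Z′ t′ t″) , record
  { atom  = λ (_ , z , z′) → let (f , g) = B.atom z ; (f′ , g′) = B′.atom z′
                             in f′ ∘ f , g ∘ g′
  ; forth = λ (_ , z , z′) r →
      let (u′ , r′ , y) = B.forth z r ; (u″ , r″ , y′) = B′.forth z′ r′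
      in u″ , r″ , u′ , y , y′
  ; back  = λ (_ , z , z′) r″ →
      let (u′ , r′ , y′) = B′.back z′ r″ ; (u , r , y) = B.back z r′
      in u , r , u′ , y , y′
  } , _ , z , z′
  where module B = IsBisimulation bis
        module B′ = IsBisimulation bis′

bisimulation-preserves : ∀ {Z} → IsBisimulation M M′ Z → ∀ φ {t t′} → Z t t′ →
                         M , t ⊨ φ → M′ , t′ ⊨ φ
bisimulation-preserves {M = M} {M′ = M′} {Z = Z} bis = go
  where
  open IsBisimulation bis
  go : ∀ φ {t t′} → Z t t′ → M , t ⊨ φ → M′ , t′ ⊨ φ
  go (var p) z h           = proj₁ (atom z) h
  go (◇ φ)   z (u , r , h) = let (u′ , r′ , y) = forth z r in u′ , r′ , go φ y h
  go (□ φ)   z h u′ r′     = let (u , r , y) = back z r′ in go φ y (h u r)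
  go (φ ∧ ψ) z (h₁ , h₂)   = go φ z h₁ , go ψ z h₂
  go (φ ∨ ψ) z             = Sum.map (go φ z) (go ψ z)

⊨-resp-↔ : ∀ φ → 𝕄 ↔ 𝕄′ → 𝕄 ⊨ φ → 𝕄′ ⊨ φ
⊨-resp-↔ φ (_ , bis , z) = bisimulation-preserves bis φ z

-- Variables are the only atoms and the point sees itself, so no formula, not even a box, holds
-- vacuously. The hypothesis for a variable is empty, hence no clause.
↻∅-⊭ : ∀ (φ : Formula Var) → ¬ ↻∅ ⊨ φ
↻∅-⊭ (◇ φ)   (_ , _ , h) = ↻∅-⊭ φ h
↻∅-⊭ (□ φ)   h           = ↻∅-⊭ φ (h tt tt)
↻∅-⊭ (φ ∧ ψ) (h , _)     = ↻∅-⊭ φ h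
↻∅-⊭ (φ ∨ ψ) (inj₁ h)    = ↻∅-⊭ φ h
↻∅-⊭ (φ ∨ ψ) (inj₂ h)    = ↻∅-⊭ ψ h

↻Prop-⊨ : ∀ (φ : Formula Var) → ↻Prop ⊨ φ
↻Prop-⊨ (var p) = tt
↻Prop-⊨ (◇ φ)   = tt , tt , ↻Prop-⊨ φ
↻Prop-⊨ (□ φ)   = λ _ _ → ↻Prop-⊨ φ
↻Prop-⊨ (φ ∧ ψ) = ↻Prop-⊨ φ , ↻Prop-⊨ ψ
↻Prop-⊨ (φ ∨ ψ) = inj₁ (↻Prop-⊨ φ)

weakSimulation-preserves : ∀ {Z} → IsWeakSimulation M M′ Z → ∀ φ {t t′} → Z t t′ →
                           M , t ⊨ φ → M′ , t′ ⊨ φ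
weakSimulation-preserves {M = M} {M′ = M′} {Z = Z} sim = go
  where
  open IsWeakSimulation sim
  go : ∀ φ {t t′} → Z t t′ → M , t ⊨ φ → M′ , t′ ⊨ φ
  go (var p) z h = atom z h
  go (◇ φ)   z (u , r , h) with forth′ z r
  ... | inj₁ u↔∅          = contradiction (⊨-resp-↔ φ u↔∅ h) (↻∅-⊭ φ)
  ... | inj₂ (u′ , r′ , y) = u′ , r′ , go φ y h
  go (□ φ)   z h u′ r′ with back′ z r′
  ... | inj₁ u′↔Prop     = ⊨-resp-↔ φ (↔-sym u′↔Prop) (↻Prop-⊨ φ)
  ... | inj₂ (u , r , y) = go φ y (h u r)
  go (φ ∧ ψ) z (h₁ , h₂) = go φ z h₁ , go ψ z h₂
  go (φ ∨ ψ) z           = Sum.map (go φ z) (go ψ z)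

⊨-resp-≼ : ∀ φ → 𝕄 ≼ 𝕄′ → 𝕄 ⊨ φ → 𝕄′ ⊨ φ
⊨-resp-≼ φ (_ , sim , z) = weakSimulation-preserves sim φ z

↔∅⇒negate↔Prop : 𝕄 ↔ ↻∅ → negate 𝕄 ↔ ↻Prop
↔∅⇒negate↔Prop (Z , bis , z) = Z , record
  { atom  = λ z → (λ _ → tt) , λ _ → proj₁ (B.atom z)
  ; forth = B.forth
  ; back  = B.back
  } , z
  where module B = IsBisimulation bis

negate↔Prop⇒↔∅ : negate 𝕄 ↔ ↻Prop → 𝕄 ↔ ↻∅
negate↔Prop⇒↔∅ (Z , bis , z) = Z , record
  { atom  = λ z → (λ p → proj₂ (B.atom z) tt p) , λ ()
  ; forth = B.forth
  ; back  = B.back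
  } , z
  where module B = IsBisimulation bis

-- The converse relation works: complementing valuations reverses inclusions and swaps the two
-- exemptions. With `negate` on the right of both sides, no double complement arises.
≼-negate : 𝕄 ≼ negate 𝕄′ → 𝕄′ ≼ negate 𝕄
≼-negate (Z , sim , z) = (λ t′ t → Z t t′) , record
  { atom   = λ z p′ p → S.atom z p p′
  ; forth′ = λ z r′ → Sum.map₁ negate↔Prop⇒↔∅ (S.back′ z r′)
  ; back′  = λ z r → Sum.map₁ ↔∅⇒negate↔Prop (S.forth′ z r)
  } , z
  where module S = IsWeakSimulation sim

-- The total relation works, as the only successor on the left is exempt in `forth′`. Thus `↻∅` is
-- least and can serve as a child lying below any successor.
↻∅-≼ : ↻∅ ≼ 𝕄
↻∅-≼ = (λ _ _ → ⊤) , record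
  { atom   = λ _ ()
  ; forth′ = λ _ _ → inj₁ ↔-refl
  ; back′  = λ _ _ → inj₂ (tt , tt , tt)
  } , tt

-- Models joined under a new root

-- No edge leaves a component, so its inclusion is a bisimulation.
▼-inner : ∀ {P : Pred Var 0ℓ} i {t} →
          (model (lookup 𝔼s i) ▸ t) ↔ (model (▼ P 𝔼s) ▸ just (i , t))
▼-inner i = (λ t x → x ≡ just (i , t)) , record
  { atom  = λ { refl → id , id }
  ; forth = λ { refl r → _ , inner i r , refl }
  ; back  = λ { refl (inner _ r) → _ , r , refl }
  } , refl

▼-⊨-◇ : ∀ {P : Pred Var 0ℓ} φ → Any (_⊨ φ) 𝔼s → ▼ P 𝔼s ⊨ ◇ φ
▼-⊨-◇ φ any = _ , root (Any.index any) ,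
  ⊨-resp-↔ φ (▼-inner (Any.index any)) (Anyₚ.lookup-index any)

▼-⊨-□ : ∀ {P : Pred Var 0ℓ} φ → All (_⊨ φ) 𝔼s → ▼ P 𝔼s ⊨ □ φ
▼-⊨-□ φ all _ (root i) = ⊨-resp-↔ φ (▼-inner i) (All.lookup all (∈-lookup i))

IsBelowSuccessor : (M : Model Var) → dom M → PointedModel Var → Set₁
IsBelowSuccessor M s 𝔼 = ∃[ u ] R M s u × 𝔼 ≼ (M ▸ u)

-- Conjunctions, disjunctions and normal forms

⋀⁺ : ∀ φs → All⁺ (𝕄 ⊨_) φs → 𝕄 ⊨ ⋀ φs
⋀⁺ (φ ∷ [])     (h ∷ _)  = h
⋀⁺ (φ ∷ ψ ∷ φs) (h ∷ hs) = h , ⋀⁺ (ψ ∷ φs) hs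

⋀⁻ : ∀ φs → 𝕄 ⊨ ⋀ φs → All⁺ (𝕄 ⊨_) φs
⋀⁻ {𝕄 = 𝕄} (φ ∷ φs) = go φ φs
  where
  go : ∀ φ φs → 𝕄 ⊨ ⋀ (φ ∷ φs) → All (𝕄 ⊨_) (φ ∷ φs)
  go φ []       h        = h ∷ []
  go φ (ψ ∷ φs) (h , hs) = h ∷ go ψ φs hs

⋁⁺ : ∀ φs → Any (𝕄 ⊨_) (toList φs) → 𝕄 ⊨ ⋁ φs
⋁⁺ (φ ∷ [])     (here h)  = h
⋁⁺ (φ ∷ ψ ∷ φs) (here h)  = inj₁ h
⋁⁺ (φ ∷ ψ ∷ φs) (there h) = inj₂ (⋁⁺ (ψ ∷ φs) h)

⋁⁻ : ∀ φs → 𝕄 ⊨ ⋁ φs → Any (𝕄 ⊨_) (toList φs)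
⋁⁻ (φ ∷ [])     h        = here h
⋁⁻ (φ ∷ ψ ∷ φs) (inj₁ h) = here h
⋁⁻ (φ ∷ ψ ∷ φs) (inj₂ h) = there (⋁⁻ (ψ ∷ φs) h)

⌜⌝ⁿ⁺ : ∀ (φs : NF Var k) → Any (λ φ → 𝕄 ⊨ ⌜ φ ⌝) (toList φs) → 𝕄 ⊨ ⌜ φs ⌝ⁿ
⌜⌝ⁿ⁺ φs = ⋁⁺ _ ∘ Anyₚ.map⁺

⌜⌝ⁿ⁻ : ∀ (φs : NF Var k) → 𝕄 ⊨ ⌜ φs ⌝ⁿ → Any (λ φ → 𝕄 ⊨ ⌜ φ ⌝) (toList φs)
⌜⌝ⁿ⁻ φs = Anyₚ.map⁻ ∘ ⋁⁻ _

toList-⧺ : ∀ {A : Set} (xs : List A) ys → toList (xs ⧺ ys) ≡ xs ++ toList ys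
toList-⧺ []       ys = refl
toList-⧺ (x ∷ xs) ys = cong (x ∷_) (toList-⧺ xs ys)

vars-⋀⁺ : ∀ π φs → All (v (model 𝕄) (point 𝕄)) π → All⁺ (𝕄 ⊨_) φs →
          𝕄 ⊨ ⋀ (List.map var π ⧺ φs)
vars-⋀⁺ {𝕄 = 𝕄} π φs ps hs = ⋀⁺ _ (subst (All (𝕄 ⊨_))
  (sym (toList-⧺ (List.map var π) φs)) (Allₚ.++⁺ (Allₚ.map⁺ ps) hs))

vars-⋀⁻ : ∀ π φs → 𝕄 ⊨ ⋀ (List.map var π ⧺ φs) →
          All (v (model 𝕄) (point 𝕄)) π × All⁺ (𝕄 ⊨_) φs
vars-⋀⁻ {𝕄 = 𝕄} π φs h = Allₚ.map⁻ (Allₚ.++⁻ˡ _ hs) , Allₚ.++⁻ʳ (List.map var π) hs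
  where
  hs : All (𝕄 ⊨_) (List.map var π ++ toList φs)
  hs = subst (All (𝕄 ⊨_)) (toList-⧺ (List.map var π) φs) (⋀⁻ _ h)

conj-⊨⁺ : ∀ (π : List⁺ Var) → All (v (model 𝕄) (point 𝕄)) (toList π) →
          𝕄 ⊨ ⌜ conj {k = k} π ⌝
conj-⊨⁺ π ps = ⋀⁺ (List⁺.map var π) (Allₚ.map⁺ ps)

conj-⊨⁻ : ∀ (π : List⁺ Var) → 𝕄 ⊨ ⌜ conj {k = k} π ⌝ →
          All (v (model 𝕄) (point 𝕄)) (toList π)
conj-⊨⁻ π h = Allₚ.map⁻ (⋀⁻ (List⁺.map var π) h)

⌜lift⌝ : ∀ (k≤l : k ≤ l) (φ : BNF Var k) → ⌜ Defs.lift k≤l φ ⌝ ≡ ⌜ φ ⌝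
⌜lift⌝ k≤l       (conj π)          = refl
⌜lift⌝ (s≤s k≤l) (conj-◇ π φs)     = cong (λ χs → ⋀ (List.map var π ⧺ χs))
  (trans (sym (List⁺ₚ.map-∘ φs)) (List⁺ₚ.map-cong (cong ◇_ ∘ ⌜lift⌝ k≤l) φs))
⌜lift⌝ (s≤s k≤l) (conj-□ π ψs)     = cong (λ χs → ⋀ (List.map var π ⧺ List⁺.[ □ ⋁ χs ]))
  (trans (sym (List⁺ₚ.map-∘ ψs)) (List⁺ₚ.map-cong (⌜lift⌝ k≤l) ψs))
⌜lift⌝ (s≤s k≤l) (conj-◇□ π φs ψs) =
  cong₂ (λ χs θs → ⋀ (List.map var π ⧺ (χs List⁺.⁺++ [ □ ⋁ θs ])))
    (trans (sym (List⁺ₚ.map-∘ φs)) (List⁺ₚ.map-cong (cong ◇_ ∘ ⌜lift⌝ k≤l) φs))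
    (trans (sym (List⁺ₚ.map-∘ ψs)) (List⁺ₚ.map-cong (⌜lift⌝ k≤l) ψs))

-- Choices and subsets

-- `P` records that each diamond has its witness among the children, `Q` that every child obeys the
-- box.
choices-All : ∀ {B : Set} {A : Set₁} {P : B → A → Set} {Q : A → Set} (f : B → List A) bs →
              (∀ b → All (λ x → P b x × Q x) (f b)) →
              All (λ xs → All (λ b → Any (P b) xs) bs × All Q xs) (choices (List.map f bs))
choices-All f []       h = ([] , []) ∷ []
choices-All f (b ∷ bs) h = Allₚ.cartesianProductWith⁺ (setoid _) (setoid _) _∷_ (f b) _
  λ x∈ xs∈ → let (p , q) = All.lookup (h b) x∈ ; (ps , qs) = All.lookup (choices-All f bs h) xs∈
             in here p ∷ All.map there ps , q ∷ qs

choices-Any : ∀ {B : Set} {A : Set₁} {P : A → Set₁} (f : B → List A) bs →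
              All (λ b → Any P (f b)) bs → Any (All P) (choices (List.map f bs))
choices-Any f []       []       = here []
choices-Any f (b ∷ bs) (p ∷ ps) = Anyₚ.cartesianProductWith⁺ _∷_ _∷_ p (choices-Any f bs ps)

module _ {A : Set₁} {P : A → Set} where

  mutual

    nonEmptySubsets-All : ∀ {xs} → All P xs → All (All P) (nonEmptySubsets xs)
    nonEmptySubsets-All []       = []
    nonEmptySubsets-All (p ∷ ps) = Allₚ.++⁺
      (Allₚ.map⁺ (All.map (p ∷_) (subsets-All ps))) (nonEmptySubsets-All ps)

    subsets-All : ∀ {xs} → All P xs → All (All P) (subsets xs)
    subsets-All ps = [] ∷ nonEmptySubsets-All ps

-- Classical filtering and weak simulations out of `▼`

module _ (em : ExcludedMiddle (suc 0ℓ)) where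

  module _ {A : Set₁} (P : A → Set₁) where

    IsFilter : List A → List A → Set₁
    IsFilter xs ys = All P ys × (∀ {x} → x ∈ xs → P x → x ∈ ys)

    -- Excluded middle decides `P` at each element. If the head fails, the given witness lies in the
    -- tail, so the filtered list is never empty.
    filter∈nonEmptySubsets : ∀ {xs} → Any P xs → Any (IsFilter xs) (nonEmptySubsets xs)
    filter∈subsets : ∀ xs → Any (IsFilter xs) (subsets xs)

    filter∈nonEmptySubsets {x ∷ xs} any with em {P x}
    ... | yes p = Anyₚ.++⁺ˡ (Anyₚ.map⁺ (Any.map
      (λ (ps , c) → p ∷ ps , λ { (here refl) _ → here refl ; (there i) q → there (c i q) })
      (filter∈subsets xs)))
    ... | no ¬p with any
    ...   | here p  = contradiction p ¬p
    ...   | there a = Anyₚ.++⁺ʳ (List.map (x ∷_) (subsets xs)) (Any.map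
      (λ (ps , c) → ps , λ { (here refl) q → contradiction q ¬p ; (there i) q → c i q })
      (filter∈nonEmptySubsets a))

    filter∈subsets xs with em {Any P xs}
    ... | yes any = there (filter∈nonEmptySubsets any)
    ... | no ¬any = here ([] , λ i q → contradiction (lose i q) ¬any)

  -- Excluded middle resizes the Set₁-valued relation ≼ to Set, so that the
  -- largest weak simulation is available as a relation on the worlds of ▼ P 𝔼s.
  ▼-≼ : ∀ {P : Pred Var 0ℓ} {𝔼s M s} → P ⊆ v M s →
        All (λ 𝔼 → (𝔼 ↔ ↻∅) ⊎ IsBelowSuccessor M s 𝔼) 𝔼s →
        (∀ u → R M s u → Any (_≼ (M ▸ u)) 𝔼s) →
        ▼ P 𝔼s ≼ (M ▸ s)
  ▼-≼ {P = P} {𝔼s} {M} {s} P⊆ forth back = Z , record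
    { atom   = λ { {nothing} refl → P⊆
                 ; {just _} z → let (_ , sim , z) = toWitness z
                                in IsWeakSimulation.atom sim z }
    ; forth′ = λ { {nothing} refl (root i) → fromRoot i (All.lookup forth (∈-lookup i))
                 ; {just _} z (inner i r) → fromInner z r }
    ; back′  = λ { {nothing} refl r → inj₂ (toRoot (back _ r))
                 ; {just _} z r → toInner z r }
    } , refl
    where
    Z : dom (model (▼ P 𝔼s)) → dom M → Set
    Z nothing        u = u ≡ s
    Z (just (i , t)) u = True (em {(model (lookup 𝔼s i) ▸ t) ≼ (M ▸ u)})

    fromRoot : ∀ i → (lookup 𝔼s i ↔ ↻∅) ⊎ IsBelowSuccessor M s (lookup 𝔼s i) →
               ((model (▼ P 𝔼s) ▸ just (i , point (lookup 𝔼s i))) ↔ ↻∅) ⊎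
               (∃[ u ] R M s u × Z (just (i , point (lookup 𝔼s i))) u)
    fromRoot i (inj₁ E↔∅)         = inj₁ (↔-trans (↔-sym (▼-inner i)) E↔∅)
    fromRoot i (inj₂ (u , r , w)) = inj₂ (u , r , fromWitness w)

    toRoot : ∀ {u} → Any (_≼ (M ▸ u)) 𝔼s → ∃[ x ] ▼R 𝔼s nothing x × Z x u
    toRoot any = _ , root (Any.index any) , fromWitness (Anyₚ.lookup-index any)

    fromInner : ∀ {i t t′ u} → Z (just (i , t)) t′ → R (model (lookup 𝔼s i)) t u →
                ((model (▼ P 𝔼s) ▸ just (i , u)) ↔ ↻∅) ⊎
                (∃[ u′ ] R M t′ u′ × Z (just (i , u)) u′)
    fromInner {i} z r with toWitness z
    -- The simulation that relates the current pair also relates the matching successors.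
    ... | _ , sim , y = Sum.map (↔-trans (↔-sym (▼-inner i)))
      (λ (u′ , r′ , y′) → u′ , r′ , fromWitness (_ , sim , y′))
      (IsWeakSimulation.forth′ sim y r)

    toInner : ∀ {i t t′ u′} → Z (just (i , t)) t′ → R M t′ u′ →
              ((M ▸ u′) ↔ ↻Prop) ⊎ (∃[ x ] ▼R 𝔼s (just (i , t)) x × Z x u′)
    toInner {i} z r with toWitness z
    ... | _ , sim , y = Sum.map₂
      (λ (u , r , y′) → just (i , u) , inner i r , fromWitness (_ , sim , y′))
      (IsWeakSimulation.back′ sim y r)

  -- The child `↻∅` is exempt in `forth′` and lies below every successor, so only the variables at
  -- the root matter.
  ▼↻∅-≼ : ∀ {P : Pred Var 0ℓ} → P ⊆ v (model 𝕄) (point 𝕄) → ▼ P [ ↻∅ ] ≼ 𝕄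
  ▼↻∅-≼ P⊆ = ▼-≼ P⊆ (inj₁ ↔-refl ∷ []) (λ _ _ → here ↻∅-≼)

  -- Complemented valuations and the dual formula

  em₀ : ExcludedMiddle 0ℓ
  em₀ = map′ lower lift em

  -- Excluded middle enters at `□` and `∧`, where a successor or a disjunct has to be extracted from
  -- a refutation.
  negate-⊨-◁ : ∀ φ → ¬ 𝕄 ⊨ φ → negate 𝕄 ⊨ ◁ φ
  negate-⊨-◁ (var p) h = h
  negate-⊨-◁ (◇ φ)   h = λ t r → negate-⊨-◁ φ (λ g → h (t , r , g))
  negate-⊨-◁ (□ φ) h = decidable-stable em₀ λ ¬◇ →
    h λ t r → decidable-stable em₀ λ ¬g → ¬◇ (t , r , negate-⊨-◁ φ ¬g)
  negate-⊨-◁ {𝕄 = 𝕄} (φ ∧ ψ) h with em₀ {𝕄 ⊨ φ}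
  ... | yes g = inj₂ (negate-⊨-◁ ψ (λ g′ → h (g , g′)))
  ... | no ¬g = inj₁ (negate-⊨-◁ φ ¬g)
  negate-⊨-◁ (φ ∨ ψ) h = negate-⊨-◁ φ (h ∘ inj₁) , negate-⊨-◁ ψ (h ∘ inj₂)

◁-negate-⊭ : ∀ φ → 𝕄 ⊨ ◁ φ → ¬ negate 𝕄 ⊨ φ
◁-negate-⊭ (var p) h           g            = g h
◁-negate-⊭ (◇ φ)   h           (t , r , g)  = ◁-negate-⊭ φ (h t r) g
◁-negate-⊭ (□ φ)   (t , r , h) g            = ◁-negate-⊭ φ h (g t r)
◁-negate-⊭ (φ ∧ ψ) (inj₁ h)    (g , _)      = ◁-negate-⊭ φ h g
◁-negate-⊭ (φ ∧ ψ) (inj₂ h)    (_ , g)      = ◁-negate-⊭ ψ h g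
◁-negate-⊭ (φ ∨ ψ) (h , _)     (inj₁ g)     = ◁-negate-⊭ φ h g
◁-negate-⊭ (φ ∨ ψ) (_ , h)     (inj₂ g)     = ◁-negate-⊭ ψ h g

-- Positive examples satisfy their formula

module _ {Var : Set} (N : NormalForms Var) where

  open NormalForms N

  lifted-nf : ∀ {k} ξ (ξ≤k : depth ξ ≤ k) → NF Var k
  lifted-nf ξ ξ≤k = List⁺.map (Defs.lift ξ≤k) (nf ξ)

  ⊨-lifted-nf⁺ : ∀ {k} ξ (ξ≤k : depth ξ ≤ k) → 𝕄 ⊨ ξ → 𝕄 ⊨ ⌜ lifted-nf ξ ξ≤k ⌝ⁿ
  ⊨-lifted-nf⁺ {𝕄 = 𝕄} ξ ξ≤k h = ⌜⌝ⁿ⁺ (lifted-nf ξ ξ≤k)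
    (Anyₚ.map⁺ (Any.map (λ {χ} → subst (𝕄 ⊨_) (sym (⌜lift⌝ ξ≤k χ)))
      (⌜⌝ⁿ⁻ (nf ξ) (Equivalence.to (nf-equiv ξ 𝕄) h))))

  ⊨-lifted-nf⁻ : ∀ {k} ξ (ξ≤k : depth ξ ≤ k) → 𝕄 ⊨ ⌜ lifted-nf ξ ξ≤k ⌝ⁿ → 𝕄 ⊨ ξ
  ⊨-lifted-nf⁻ {𝕄 = 𝕄} ξ ξ≤k h = Equivalence.from (nf-equiv ξ 𝕄)
    (⌜⌝ⁿ⁺ (nf ξ) (Any.map (λ {χ} → subst (𝕄 ⊨_) (⌜lift⌝ ξ≤k χ))
      (Anyₚ.map⁻ (⌜⌝ⁿ⁻ (lifted-nf ξ ξ≤k) h))))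

  -- The normal form used by `E⁺∧`. It is no subformula of the one being treated, but it stays at
  -- level `k`, so induction on the level reaches it.
  ∧-nf : BNF Var k → BNF Var k → NF Var k
  ∧-nf φ ψ = lifted-nf (⌜ φ ⌝ ∧ ⌜ ψ ⌝) (⊔-lub (⌜⌝-shallow φ) (⌜⌝-shallow ψ))

  mutual

    E⁺ᵇ-sound : ∀ k φ → All (_⊨ ⌜ φ ⌝) (E⁺ᵇ N k φ)
    E⁺ᵇ-sound ℕ.zero    (conj π) = conj-⊨⁺ {k = 0} π (All.tabulate id) ∷ []
    E⁺ᵇ-sound (ℕ.suc k) (conj π) = conj-⊨⁺ {k = ℕ.suc k} π (All.tabulate id) ∷ []
    E⁺ᵇ-sound (ℕ.suc k) (conj-◇ π φs) = Allₚ.map⁺ (All.map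
      (λ (ds , _) → vars-⋀⁺ π _ (All.tabulate id)
        (Allₚ.map⁺ (All.map (λ {φ} d → ▼-⊨-◇ ⌜ φ ⌝ (Anyₚ.++⁺ˡ d)) ds)))
      (choices-All {Q = λ _ → ⊤} (E⁺ᵇ N k) (toList φs) λ φ → All.map (_, tt) (E⁺ᵇ-sound k φ)))
    E⁺ᵇ-sound (ℕ.suc k) (conj-□ π ψs) = Allₚ.map⁺ (All.map
      (λ bs → vars-⋀⁺ π _ (All.tabulate id) (▼-⊨-□ ⌜ ψs ⌝ⁿ bs ∷ []))
      (subsets-All (E⁺ⁿ-sound k ψs)))
    E⁺ᵇ-sound (ℕ.suc k) (conj-◇□ π φs ψs) =
      Allₚ.cartesianProductWith⁺ (setoid _) (setoid _) _ _ _ λ 𝔼s∈ 𝔽s∈ →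
        -- Children chosen for diamonds come from conjunctions of some φ with some ψ, so they
        -- satisfy the box body as well.
        let (ds , bs) = All.lookup
              (choices-All (λ φ → concatMap (E⁺∧ N k φ) (toList ψs)) (toList φs)
                (λ φ → E⁺∧-sound k φ ψs)) 𝔼s∈
            bs′ = All.lookup (nonEmptySubsets-All (E⁺ⁿ-sound k ψs)) 𝔽s∈
        in vars-⋀⁺ π _ (All.tabulate id) (Allₚ.++⁺
             (Allₚ.map⁺ (All.map (λ {φ} d → ▼-⊨-◇ ⌜ φ ⌝ (Anyₚ.++⁺ˡ d)) ds))
             (▼-⊨-□ ⌜ ψs ⌝ⁿ (Allₚ.++⁺ bs bs′) ∷ []))

    E⁺ⁿ-sound : ∀ k φs → All (_⊨ ⌜ φs ⌝ⁿ) (E⁺ⁿ N k φs)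
    E⁺ⁿ-sound k φs = Allₚ.concat⁺ (Allₚ.map⁺ (All.tabulate λ {φ} φ∈ →
      All.map (λ h → ⌜⌝ⁿ⁺ φs (lose φ∈ h)) (E⁺ᵇ-sound k φ)))

    E⁺∧-sound : ∀ k φ ψs → All (λ 𝔼 → (𝔼 ⊨ ⌜ φ ⌝) × (𝔼 ⊨ ⌜ ψs ⌝ⁿ))
                               (concatMap (E⁺∧ N k φ) (toList ψs))
    E⁺∧-sound k φ ψs = Allₚ.concat⁺ (Allₚ.map⁺ (All.tabulate λ {ψ} ψ∈ →
      All.map (map₂ (λ h → ⌜⌝ⁿ⁺ ψs (lose ψ∈ h)) ∘ ⊨-lifted-nf⁻ (⌜ φ ⌝ ∧ ⌜ ψ ⌝) _)
        (E⁺ⁿ-sound k (∧-nf φ ψ))))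

  E⁺-sound : ∀ φ → All (_⊨ φ) (E⁺ N φ)
  E⁺-sound φ = All.map (λ {𝔼} → Equivalence.from (nf-equiv φ 𝔼)) (E⁺ⁿ-sound _ (nf φ))

  -- Every model of a formula lies above a positive example

  module _ (em : ExcludedMiddle (suc 0ℓ)) where

    mutual

      E⁺ᵇ-complete : ∀ k φ {𝕄} → 𝕄 ⊨ ⌜ φ ⌝ → Any (_≼ 𝕄) (E⁺ᵇ N k φ)
      E⁺ᵇ-complete ℕ.zero    (conj π) h = here (▼↻∅-≼ em (All.lookup (conj-⊨⁻ {k = 0} π h)))
      E⁺ᵇ-complete (ℕ.suc k) (conj π) h =
        here (▼↻∅-≼ em (All.lookup (conj-⊨⁻ {k = ℕ.suc k} π h)))
      E⁺ᵇ-complete (ℕ.suc k) (conj-◇ π φs) h =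
        let (ps , ds) = vars-⋀⁻ π _ h
        in Anyₚ.map⁺ (Any.map
             (λ {𝔼s} es → ▼-≼ em (All.lookup ps)
               -- The final child `↻∅` is exempt in `forth′`; in `back′` it takes care of all
               -- successors.
               (Allₚ.++⁺ (All.map inj₂ es) (inj₁ ↔-refl ∷ []))
               (λ _ _ → Anyₚ.++⁺ʳ 𝔼s (here ↻∅-≼)))
             (choices-Any (E⁺ᵇ N k) (toList φs) (All.map
               (λ {φ} (t , r , g) → Any.map (λ e → t , r , e) (E⁺ᵇ-complete k φ g))
               (Allₚ.map⁻ ds))))
      E⁺ᵇ-complete (ℕ.suc k) (conj-□ π ψs) {M ▸ s} h with vars-⋀⁻ π _ h
      ... | ps , b ∷ [] = Anyₚ.map⁺ (Any.map
        (λ (es , c) → ▼-≼ em (All.lookup ps) (All.map inj₂ es) (successors-covered k ψs b c))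
        (filter∈subsets em (IsBelowSuccessor M s) (E⁺ⁿ N k ψs)))
      E⁺ᵇ-complete (ℕ.suc k) (conj-◇□ π φs ψs) {M ▸ s} h with vars-⋀⁻ π _ h
      ... | ps , hs with Allₚ.++⁻ (toList (List⁺.map (◇_ ∘ ⌜_⌝) φs)) hs
      -- The first diamond supplies a successor `t`; an example below it shows that the filtered
      -- subset is non-empty.
      ...   | ds@((t , r , _) ∷ _) , b ∷ [] = Anyₚ.cartesianProductWith⁺ _
        (λ {𝔼s} es (es′ , c) → ▼-≼ em (All.lookup ps)
          (All.map inj₂ (Allₚ.++⁺ es es′))
          (λ u r → Anyₚ.++⁺ʳ 𝔼s (successors-covered k ψs b c u r)))
        (choices-Any (λ φ → concatMap (E⁺∧ N k φ) (toList ψs)) (toList φs) (All.map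
          -- The witness of a diamond also satisfies the box body, so an example for a conjunction
          -- lies below it.
          (λ {φ} (t , r , g) → Any.map (λ e → t , r , e) (E⁺∧-complete k φ ψs g (b t r)))
          (Allₚ.map⁻ ds)))
        (filter∈nonEmptySubsets em (IsBelowSuccessor M s)
          (Any.map (λ e → t , r , e) (E⁺ⁿ-complete k ψs (b t r))))

      -- Completeness puts an example below `u`; being below a successor, it passes the filter and
      -- so is among the children.
      successors-covered : ∀ k ψs {M : Model Var} {s 𝔽s} → (M , s ⊨ □ ⌜ ψs ⌝ⁿ) →
        (∀ {𝔼} → 𝔼 ∈ E⁺ⁿ N k ψs → IsBelowSuccessor M s 𝔼 → 𝔼 ∈ 𝔽s) →
        ∀ u → R M s u → Any (_≼ (M ▸ u)) 𝔽s
      successors-covered k ψs b c u r with find (E⁺ⁿ-complete k ψs (b u r))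
      ... | _ , 𝔼∈ , e = lose (c 𝔼∈ (u , r , e)) e

      E⁺ⁿ-complete : ∀ k φs {𝕄} → 𝕄 ⊨ ⌜ φs ⌝ⁿ → Any (_≼ 𝕄) (E⁺ⁿ N k φs)
      E⁺ⁿ-complete k φs h = Anyₚ.concatMap⁺ (E⁺ᵇ N k)
        (Any.map (λ {φ} → E⁺ᵇ-complete k φ) (⌜⌝ⁿ⁻ φs h))

      E⁺∧-complete : ∀ k φ ψs {𝕄} → 𝕄 ⊨ ⌜ φ ⌝ → 𝕄 ⊨ ⌜ ψs ⌝ⁿ →
                     Any (_≼ 𝕄) (concatMap (E⁺∧ N k φ) (toList ψs))
      E⁺∧-complete k φ ψs g h = Anyₚ.concatMap⁺ (E⁺∧ N k φ) (Any.map
        (λ {ψ} h → E⁺ⁿ-complete k (∧-nf φ ψ) (⊨-lifted-nf⁺ (⌜ φ ⌝ ∧ ⌜ ψ ⌝) _ (g , h)))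
        (⌜⌝ⁿ⁻ ψs h))

    E⁺-complete : ∀ φ → 𝕄 ⊨ φ → Any (_≼ 𝕄) (E⁺ N φ)
    E⁺-complete {𝕄 = 𝕄} φ h = E⁺ⁿ-complete _ (nf φ) (Equivalence.to (nf-equiv φ 𝕄) h)

proposition4p32 : ExcludedMiddle (suc 0ℓ) →
    (Var : Set) (N : NormalForms Var) (φ : Formula Var) →
    IsWeakSimulationDuality (E⁺ N φ) (E⁻ N φ) × Fits φ (E⁺ N φ) (E⁻ N φ)
proposition4p32 em Var N φ = (λ 𝕄 → above-or-below 𝕄 , not-both) , E⁺-sound N φ , E⁻-false
  where
  E⁻-false : All (λ 𝔼 → ¬ 𝔼 ⊨ φ) (E⁻ N φ)
  E⁻-false = Allₚ.map⁺ (All.map (◁-negate-⊭ φ) (E⁺-sound N (◁ φ)))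

  above-or-below : ∀ 𝕄 → Any (_≼ 𝕄) (E⁺ N φ) ⊎ Any (𝕄 ≼_) (E⁻ N φ)
  above-or-below 𝕄 with em₀ em {𝕄 ⊨ φ}
  ... | yes h = inj₁ (E⁺-complete N em φ h)
  -- The negated model satisfies `◁ φ`, hence lies above a positive example of `◁ φ`; negation turns
  -- this around.
  ... | no ¬h = inj₂ (Anyₚ.map⁺ (Any.map ≼-negate
                  (E⁺-complete N em (◁ φ) (negate-⊨-◁ em φ ¬h))))

  not-both : ∀ {𝕄} → ¬ (Any (_≼ 𝕄) (E⁺ N φ) × Any (𝕄 ≼_) (E⁻ N φ))
  not-both (pos , neg) with find pos | find neg
  -- Truth of `φ` would travel from `𝔼` through `𝕄` up to `𝔽`, where `φ` fails.
  ... | _ , 𝔼∈ , 𝔼≼𝕄 | _ , 𝔽∈ , 𝕄≼𝔽 =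
    All.lookup E⁻-false 𝔽∈ (⊨-resp-≼ φ 𝕄≼𝔽 (⊨-resp-≼ φ 𝔼≼𝕄 (All.lookup (E⁺-sound N φ) 𝔼∈)))
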